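{- Let $k\geq 1$ and let $m_1\leq m_2\leq \dots \leq m_k$ be positive integers, and let $n$ be an integer with $n\geq 3m_k+5m_{k-1}$. Then $$R(C_{\geq n}, K_{m_1, \dots, m_k})= (k-1)(n-1)+m_1.$$
   Context: $K_{m_1,\dots,m_k}$ denotes the complete $k$-partite graph with parts of sizes $m_1,\dots,m_k$ (all edges between distinct parts, none inside parts). $R(C_{\geq n}, H)$ is the smallest integer $N$ such that every red-blue coloring of the edges of the complete graph $K_N$ contains either a red cycle of length at least $n$ or a blue copy of $H$. -}

module Defs where

open import Data.Nat using (ℕ; zero; suc; _≤_; _<_)
open import Data.Fin using (Fin; zero; suc; inject₁; fromℕ)
open import Data.Product using (Σ; _×_)
open import Relation.Binary.PropositionalEquality using (_≡_; _≢_)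
open import Relation.Nullary using (¬_)
open import Function.Definitions using (Injective)

data Colour : Set where
  red blue : Colour

-- A red-blue colouring of the edges of K_N (vertex set Fin N).
-- Colours of ordered pairs, required to be symmetric; the diagonal is irrelevant.
record Colouring (N : ℕ) : Set where
  field
    col : Fin N → Fin N → Colour
    sym : ∀ u v → col u v ≡ col v u
open Colouring public

RedCycleAtLeast : ∀ {N} → ℕ → Colouring N → Set
RedCycleAtLeast {N} n c =
  Σ ℕ λ l → n ≤ suc l × 3 ≤ suc l ×
    Σ (Fin (suc l) → Fin N) λ f → Injective _≡_ _≡_ f ×
      (∀ (i : Fin l) → col c (f (inject₁ i)) (f (suc i)) ≡ red) ×
      col c (f (fromℕ l)) (f zero) ≡ red

KVert : (K : ℕ) → (Fin K → ℕ) → Set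
KVert K m = Σ (Fin K) λ i → Fin (m i)

BlueCompleteMultipartite : ∀ {N} → (K : ℕ) → (Fin K → ℕ) → Colouring N → Set
BlueCompleteMultipartite {N} K m c =
  Σ (KVert K m → Fin N) λ f → Injective _≡_ _≡_ f ×
    (∀ (i j : Fin K) (a : Fin (m i)) (b : Fin (m j)) → i ≢ j →
       col c (f (i Data.Product., a)) (f (j Data.Product., b)) ≡ blue)

Arrows : ℕ → ℕ → (K : ℕ) → (Fin K → ℕ) → Set
Arrows N n K m = (c : Colouring N) → RedCycleAtLeast n c Data.Sum.⊎ BlueCompleteMultipartite K m c
  where import Data.Sum

IsRamseyNumber : ℕ → (K : ℕ) → (Fin K → ℕ) → ℕ → Set
IsRamseyNumber n K m R = Arrows R n K m × (∀ N → N < R → ¬ Arrows N n K m)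

lastPart : (k : ℕ) → (Fin (suc k) → ℕ) → ℕ
lastPart k m = m (fromℕ k)

-- m_{K-1}; by convention m_0 = 0 when K = 1.
secondLastPart : (k : ℕ) → (Fin (suc k) → ℕ) → ℕ
secondLastPart zero    m = 0
secondLastPart (suc k) m = m (inject₁ (fromℕ k))

{-# OPTIONS --safe #-}

-- Upper bound, by induction on the number of parts.  If a set Z could serve as the first
-- (or the second) part and its closed red neighbourhood Γ(Z) were small, the remaining parts
-- would be found outside Γ(Z).  So sets of size a = m₁ and b = m₂ expand.  Delete a set X with
-- |X| < a and at most 2|X| outer neighbours, and apply Pósa rotations to a longest path of the
-- rest.  Let S be the set of ends obtained.  If |S| < a then X ∪ S has again at most twice its
-- size in outer neighbours; expansion forces |X ∪ S| < a, so X ∪ S may replace X.  Otherwise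
-- the first a ends have neighbours only in X, among themselves, or next to S on the path, which gives
-- |S| ≥ b + 2|X|.  Then b of the ends have no neighbour in X, so all their at least n closed
-- neighbours lie on the cycle that closes the path at its farthest vertex adjacent to S.
-- Lower bound: disjoint red cliques of size n − 1 and one of size m₁ − 1.

module Submission where

open import Defs
open import Data.Nat using (ℕ; suc; _+_; _*_; _∸_; _≤_)
open import Data.Fin using (Fin; zero)
import Data.Fin

open import Data.Nat using (zero; _<_; _/_; _%_; NonZero; z≤n; s≤s; s≤s⁻¹; _≤?_)
import Data.Nat as ℕ
open import Data.Nat.Properties hiding (_≟_)
open import Data.Nat.DivMod using (m≡m%n+[m/n]*n; m%n<n; m<n*o⇒m/o<n)
open import Data.Fin using (suc; toℕ; fromℕ; fromℕ<; inject₁; inject≤; punchIn; punchOut)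
open import Data.Fin.Properties
  using (_≟_; pigeonhole; ¬∀⟶∃¬; toℕ-injective; toℕ<n; toℕ-inject₁; fromℕ<-injective; ≤fromℕ
        ; inject≤-injective; punchIn-mono-≤; punchIn-injective; punchIn-punchOut; punchOut-injective)
  renaming (<⇒≢ to <⇒≢ᶠ)
open import Data.Nat.Tactic.RingSolver using (solve-∀)
open import Data.List using (List; []; _∷_; [_]; _++_; _ʳ++_; length; lookup; allFin; map; filter; concatMap; take)
open import Data.List.Properties using (length-++; ++-assoc; ++-ʳ++; ʳ++-defn; length-tabulate; ∷-injectiveˡ; ∷-injectiveʳ)
open import Data.List.Membership.Propositional using (_∈_; _∉_; find; lose)
open import Data.List.Membership.Propositional.Properties
  using (∈-++⁺ˡ; ∈-++⁺ʳ; ∈-++⁻; ∈-∃++; ∈-filter⁺; ∈-filter⁻; ∈-concatMap⁺; ∈-map⁺; ∈-map⁻; ∈-insert; ∈-lookup)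
open import Data.List.Relation.Binary.Subset.Propositional using (_⊆_)
open import Data.List.Relation.Binary.Permutation.Propositional using (_↭_; ↭-refl; ↭-sym; ↭-trans; prep; ↭⇒↭ₛ)
open import Data.List.Relation.Binary.Permutation.Propositional.Properties
  using (∈-resp-↭; ↭-length; ↭-reverse; ++⁺ʳ; shift)
import Data.List.Relation.Binary.Permutation.Setoid.Properties as PermSetoid
open import Data.List.Relation.Unary.All using (All; []; _∷_)
import Data.List.Relation.Unary.All as All
open import Data.List.Relation.Unary.Any using (Any; here; there; any?)
open import Data.List.Relation.Unary.AllPairs using ([]; _∷_)
open import Data.List.Relation.Unary.Unique.Propositional using (Unique)
import Data.List.Relation.Unary.Unique.Propositional.Properties as Unique
open import Data.Product using (∃; ∃₂; ∃-syntax; _×_; _,_; proj₁; proj₂)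
open import Data.Sum using (_⊎_; inj₁; inj₂; swap)
import Data.Sum as Sum
open import Function using (_∘_; id; case_of_)
open import Relation.Binary.Definitions using (DecidableEquality)
open import Relation.Binary.PropositionalEquality
  using (_≡_; _≢_; refl; trans; cong; subst; setoid; module ≡-Reasoning)
  renaming (sym to ≡-sym)
open import Relation.Nullary using (¬_; Dec; yes; no; contradiction)
open import Relation.Nullary.Decidable using (¬?; _×-dec_; _⊎-dec_; map′)

private variable
  V : Set
  u v w x y : V
  xs ys : List V

-- Finite sets as lists without repetition.

⊆-remove : ∀ (as : List V) {bs} → x ∉ xs → x ∷ xs ⊆ as ++ x ∷ bs → xs ⊆ as ++ bs
⊆-remove as x∉xs sub y∈xs with ∈-++⁻ as (sub (there y∈xs))
... | inj₁ y∈as         = ∈-++⁺ˡ y∈as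
... | inj₂ (here refl)  = contradiction y∈xs x∉xs
... | inj₂ (there y∈bs) = ∈-++⁺ʳ as y∈bs

-- Only the smaller side must be free of repetitions, so a covering list such as a union may count
-- vertices twice.
Unique-⊆⇒length≤ : Unique xs → xs ⊆ ys → length xs ≤ length ys
Unique-⊆⇒length≤ {xs = []}     _ _ = z≤n
Unique-⊆⇒length≤ {xs = x ∷ xs} (x≢ ∷ uniq) sub with ∈-∃++ (sub (here refl))
... | as , bs , refl = begin
  suc (length xs)                ≤⟨ s≤s (Unique-⊆⇒length≤ uniq (⊆-remove as x∉xs sub)) ⟩
  suc (length (as ++ bs))        ≡⟨ cong suc (length-++ as) ⟩
  suc (length as + length bs)    ≡⟨ +-suc (length as) (length bs) ⟨
  length as + suc (length bs)    ≡⟨ length-++ as ⟨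
  length (as ++ x ∷ bs)          ∎
  where
  open ≤-Reasoning
  x∉xs : x ∉ xs
  x∉xs = Unique.Unique[x∷xs]⇒x∉xs (x≢ ∷ uniq)

Unique-resp-↭ : xs ↭ ys → Unique xs → Unique ys
Unique-resp-↭ p = PermSetoid.Unique-resp-↭ (setoid _) (↭⇒↭ₛ p)

Unique-++⁻ˡ : ∀ xs → Unique (xs ++ ys) → Unique {A = V} xs
Unique-++⁻ˡ []       _           = []
Unique-++⁻ˡ (x ∷ xs) (x≢ ∷ uniq) =
  All.tabulate (λ y∈xs → All.lookup x≢ (∈-++⁺ˡ y∈xs)) ∷ Unique-++⁻ˡ xs uniq

Unique-++⇒disjoint : ∀ xs → Unique (xs ++ ys) → x ∈ xs → x ∉ ys
Unique-++⇒disjoint (_ ∷ xs) (x≢ ∷ _)   (here refl)  x∈ys = All.lookup x≢ (∈-++⁺ʳ xs x∈ys) refl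
Unique-++⇒disjoint (_ ∷ xs) (_ ∷ uniq) (there x∈xs) x∈ys = Unique-++⇒disjoint xs uniq x∈xs x∈ys

ʳ++-++ : ∀ (xs {ys zs} : List V) → xs ʳ++ (ys ++ zs) ≡ (xs ʳ++ ys) ++ zs
ʳ++-++ []       = refl
ʳ++-++ (x ∷ xs) = ʳ++-++ xs

length-concatMap≤ : ∀ {W : Set} (f : V → List W) k xs → (∀ x → length (f x) ≤ k) →
  length (concatMap f xs) ≤ k * length xs
length-concatMap≤ f k []       _ = z≤n
length-concatMap≤ f k (x ∷ xs) f≤k = begin
  length (f x ++ concatMap f xs)        ≡⟨ length-++ (f x) ⟩
  length (f x) + length (concatMap f xs) ≤⟨ +-mono-≤ (f≤k x) (length-concatMap≤ f k xs f≤k) ⟩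
  k + k * length xs                     ≡⟨ *-suc k (length xs) ⟨
  k * suc (length xs)                   ∎
  where open ≤-Reasoning

-- Consecutive vertices of a path.

data Next {V : Set} : List V → V → V → Set where
  here  : Next (u ∷ w ∷ xs) u w
  there : Next xs u w → Next (x ∷ xs) u w

Adjacent : List V → V → V → Set
Adjacent xs u w = Next xs u w ⊎ Next xs w u

Next⇒split : Next xs u w → ∃₂ λ as bs → xs ≡ as ++ u ∷ w ∷ bs
Next⇒split here = [] , _ , refl
Next⇒split (there n) with Next⇒split n
... | as , bs , refl = _ ∷ as , bs , refl

split⇒Next : ∀ as {bs} → Next (as ++ u ∷ w ∷ bs) u w
split⇒Next []       = here
split⇒Next (_ ∷ as) = there (split⇒Next as)

Next-∈ʳ : Next xs u w → w ∈ xs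
Next-∈ʳ here      = there (here refl)
Next-∈ʳ (there n) = there (Next-∈ʳ n)

Next-∈ˡ : Next xs u w → u ∈ xs
Next-∈ˡ here      = here refl
Next-∈ˡ (there n) = there (Next-∈ˡ n)

predecessor : v ∈ xs → ∃ λ u → Next (x ∷ xs) u v
predecessor (here refl) = _ , here
predecessor (there v∈) with predecessor v∈
... | u , n = u , there n

Next-++⁺ʳ : ∀ as {bs} → Next bs u w → Next (as ++ bs) u w
Next-++⁺ʳ []       n = n
Next-++⁺ʳ (_ ∷ as) n = there (Next-++⁺ʳ as n)

Next-++⁺ˡ : ∀ {as bs : List V} → Next as u w → Next (as ++ bs) u w
Next-++⁺ˡ here      = here
Next-++⁺ˡ (there n) = there (Next-++⁺ˡ n)

-- The head `x` of the reversed prefix lands right before `y`; in a rotation this junction is the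
-- added edge.
Next-ʳ++⁻ : ∀ (xs : List V) {x y ys} → Next ((x ∷ xs) ʳ++ (y ∷ ys)) u w →
  Next (x ∷ xs) w u ⊎ (u ≡ x × w ≡ y) ⊎ Next (y ∷ ys) u w
Next-ʳ++⁻ []       here      = inj₂ (inj₁ (refl , refl))
Next-ʳ++⁻ []       (there n) = inj₂ (inj₂ n)
Next-ʳ++⁻ (z ∷ xs) n with Next-ʳ++⁻ xs n
... | inj₁ m                    = inj₁ (there m)
... | inj₂ (inj₁ (refl , refl)) = inj₁ here
... | inj₂ (inj₂ here)          = inj₂ (inj₁ (refl , refl))
... | inj₂ (inj₂ (there m))     = inj₂ (inj₂ m)

anyNext? : {D : V → V → Set} → (∀ u w → Dec (D u w)) → ∀ xs →
  Dec (∃₂ λ u w → Next xs u w × D u w)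
anyNext? D? []           = no λ { (_ , _ , () , _) }
anyNext? D? (x ∷ [])     = no λ { (_ , _ , there () , _) }
anyNext? D? (x ∷ y ∷ xs) = map′
  (λ { (inj₁ d) → x , y , here , d ; (inj₂ (u , w , n , d)) → u , w , there n , d })
  (λ { (_ , _ , here , d) → inj₁ d ; (u , w , there n , d) → inj₂ (u , w , n , d) })
  (D? x y ⊎-dec anyNext? D? (y ∷ xs))

-- As `w` does not occur in `fs`, the cut before `w` comes no later than the cut before `v`.
suffix-split : ∀ (as {bs} ms : List V) {v w fs} → w ∉ fs → as ++ w ∷ bs ≡ ms ++ v ∷ fs →
  ∃ λ ms′ → w ∷ bs ≡ ms′ ++ v ∷ fs
suffix-split []       ms       _   eq   = ms , eq
suffix-split (a ∷ as) []       w∉fs refl = contradiction (∈-insert as) w∉fs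
suffix-split (a ∷ as) (m ∷ ms) w∉fs eq  = suffix-split as ms w∉fs (∷-injectiveʳ eq)

-- The head is accepted untested, as the default when nothing after it satisfies `D`; then `ms` is
-- empty.
splitLast : {D : V → Set} → (∀ v → Dec (D v)) → ∀ x xs →
  ∃[ ms ] ∃[ v ] ∃[ fs ] x ∷ xs ≡ ms ++ v ∷ fs × (∀ {w} → w ∈ fs → ¬ D w) × (D v ⊎ ms ≡ [])
splitLast D? x []       = [] , x , [] , refl , (λ ()) , inj₂ refl
splitLast D? x (y ∷ xs) with splitLast D? y xs
... | ms , v , fs , eq , free , inj₁ d = x ∷ ms , v , fs , cong (x ∷_) eq , free , inj₁ d
... | .[] , v , fs , refl , free , inj₂ refl with D? y
...   | yes d = [ x ] , y , fs , refl , free , inj₁ d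
...   | no ¬d = [] , x , y ∷ fs , refl , (λ { (here refl) → ¬d ; (there w∈) → free w∈ }) , inj₂ refl

-- Neighbours of a vertex along a path.

module _ {V : Set} (_≟_ : DecidableEquality V) where

  after : V → List V → List V
  after u [] = []
  after u (x ∷ xs) with x ≟ u
  ... | yes _ = take 1 xs
  ... | no  _ = after u xs

  before : V → V → List V → List V
  before w x [] = []
  before w x (y ∷ ys) with y ≟ w
  ... | yes _ = [ x ]
  ... | no  _ = before w y ys

  length-after : ∀ u xs → length (after u xs) ≤ 1
  length-after u []       = z≤n
  length-after u (x ∷ xs) with x ≟ u
  ... | yes _ = length-take≤ xs
    where
    length-take≤ : ∀ xs → length (take 1 xs) ≤ 1
    length-take≤ []      = z≤n
    length-take≤ (_ ∷ _) = s≤s z≤n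
  ... | no  _ = length-after u xs

  length-before : ∀ w x ys → length (before w x ys) ≤ 1
  length-before w x []       = z≤n
  length-before w x (y ∷ ys) with y ≟ w
  ... | yes _ = s≤s z≤n
  ... | no  _ = length-before w y ys

  ∈-after : ∀ {xs u w} → Unique xs → Next xs u w → w ∈ after u xs
  ∈-after {x ∷ xs} {u} (x≢ ∷ uniq) n with x ≟ u | n
  ... | yes _    | here    = here refl
  ... | yes refl | there m = contradiction refl (All.lookup x≢ (Next-∈ˡ m))
  ... | no x≢u   | here    = contradiction refl x≢u
  ... | no _     | there m = ∈-after uniq m

  ∈-before : ∀ {x ys u w} → Unique (x ∷ ys) → Next (x ∷ ys) u w → u ∈ before w x ys
  ∈-before {x} {y ∷ ys} {w = w} (_ ∷ uniq@(y≢ ∷ _)) n with y ≟ w | n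
  ... | yes _    | here            = here refl
  ... | yes refl | there here      = contradiction refl (All.lookup y≢ (here refl))
  ... | yes refl | there (there m) = contradiction refl (All.lookup y≢ (Next-∈ʳ m))
  ... | no y≢w   | here            = contradiction refl y≢w
  ... | no _     | there m         = ∈-before uniq m
  ∈-before {x} {[]} _ (there ())

  beside : List V → V → List V
  beside []       s = []
  beside (x ∷ xs) s = after s (x ∷ xs) ++ before s x xs

  length-beside : ∀ P s → length (beside P s) ≤ 2
  length-beside []       s = z≤n
  length-beside (x ∷ xs) s = begin
    length (beside (x ∷ xs) s)                          ≡⟨ length-++ (after s (x ∷ xs)) ⟩
    length (after s (x ∷ xs)) + length (before s x xs)  ≤⟨ +-mono-≤ (length-after s (x ∷ xs)) (length-before s x xs) ⟩
    2                                                   ∎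
    where open ≤-Reasoning

  ∈-beside : ∀ {P s v} → Unique P → Adjacent P s v → v ∈ beside P s
  ∈-beside {x ∷ xs} uniq (inj₁ n) = ∈-++⁺ˡ (∈-after uniq n)
  ∈-beside {x ∷ xs} {s} uniq (inj₂ n) = ∈-++⁺ʳ (after s (x ∷ xs)) (∈-before uniq n)

  besides : List V → List V → List V
  besides P = concatMap (beside P)

  -- A vertex has at most a predecessor and a successor on `P`; the factor 2 in the bounds on outer
  -- neighbours comes from here.
  length-besides : ∀ P S → length (besides P S) ≤ 2 * length S
  length-besides P S = length-concatMap≤ (beside P) 2 S (length-beside P)

  ∈-besides : ∀ {P S s v} → Unique P → s ∈ S → Adjacent P s v → v ∈ besides P S
  ∈-besides {P} uniq s∈S adj = ∈-concatMap⁺ (beside P) (lose s∈S (∈-beside uniq adj))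

-- Pósa rotations.

module Graph {V : Set} (_≟_ : DecidableEquality V)
  (_~_ : V → V → Set) (_~?_ : ∀ u v → Dec (u ~ v)) (~-sym : ∀ {u v} → u ~ v → v ~ u) where

  open import Data.List.Membership.DecPropositional _≟_ using (_∈?_; _∉?_)

  IsPath : List V → Set
  IsPath xs = ∀ {u w} → Next xs u w → u ~ w

  Adjacent⇒~ : ∀ {xs u w} → IsPath xs → Adjacent xs u w → u ~ w
  Adjacent⇒~ path (inj₁ n) = path n
  Adjacent⇒~ path (inj₂ n) = ~-sym (path n)

  -- A nonempty path is stored as its active end together with the remaining vertices.
  End : Set
  End = V × List V

  vertices : End → List V
  vertices (s , q) = s ∷ q

  ends : List End → List V
  ends = map proj₁

  -- One path is kept for each end, the newest first, and a rotation may start from any of them.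
  -- Reversing `as`, which begins with `s`, replaces the edge between `s′` and `v` by the one
  -- between `s` and `v`. The condition on `s′` keeps the ends distinct.
  data Rotations (P : List V) : List End → Set where
    start : ∀ {e p} → P ≡ e ∷ p → Rotations P [ (e , p) ]
    rotate : ∀ {T s q s′ v} as {bs} → Rotations P T → (s , q) ∈ T →
      s ∷ q ≡ as ++ s′ ∷ v ∷ bs → s ~ v → s′ ∉ ends T →
      Rotations P ((s′ , as ʳ++ v ∷ bs) ∷ T)

  Touched : List V → List V → V → Set
  Touched P S u = u ∈ S ⊎ (∃[ s ] s ∈ S × Adjacent P s u)

  -- The last field says that rotations never disturb the part of P beyond the last
  -- vertex with a neighbour among the ends.
  record Rotated (P S : List V) (Q : End) : Set where
    field
      perm  : vertices Q ↭ P
      path  : IsPath (vertices Q)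
      old   : ∀ {u w} → Adjacent (vertices Q) u w → Adjacent P u w ⊎ Touched P S u
      fixed : ∀ ms {v fs} → P ≡ ms ++ v ∷ fs → (∀ {s w} → s ∈ S → w ∈ fs → ¬ s ~ w) →
        ∃ λ ms′ → vertices Q ≡ ms′ ++ v ∷ fs
  open Rotated

  Rotated-weaken : ∀ {P S s Q} → Rotated P S Q → Rotated P (s ∷ S) Q
  Rotated-weaken r .perm  = r .perm
  Rotated-weaken r .path  = r .path
  Rotated-weaken r .old a with r .old a
  ... | inj₁ a′                         = inj₁ a′
  ... | inj₂ (inj₁ u∈S)                 = inj₂ (inj₁ (there u∈S))
  ... | inj₂ (inj₂ (s , s∈S , a′))      = inj₂ (inj₂ (s , there s∈S , a′))
  Rotated-weaken r .fixed ms eq free = r .fixed ms eq (free ∘ there)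

  -- The new path is the reversal of `as ++ [ s′ ]` followed by `v ∷ bs`, so only the junction of
  -- `s` and `v` can be new. If `as` is empty, nothing changes.
  Next-rotate : ∀ (as : List V) {s q s′ v bs u w} → s ∷ q ≡ as ++ s′ ∷ v ∷ bs →
    Next (s′ ∷ (as ʳ++ v ∷ bs)) u w → Adjacent (s ∷ q) u w ⊎ (u ≡ s × w ≡ v)
  Next-rotate [] refl n = inj₁ (inj₁ n)
  Next-rotate (s ∷ as) {s′ = s′} {v} {bs} {u} {w} refl n
    with Next-ʳ++⁻ (as ++ [ s′ ]) (subst (λ xs → Next xs u w) (≡-sym (++-ʳ++ (s ∷ as) {[ s′ ]})) n)
  ... | inj₁ m        = inj₁ (inj₂ (subst (λ xs → Next xs w u) (++-assoc (s ∷ as) [ s′ ] (v ∷ bs)) (Next-++⁺ˡ m)))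
  ... | inj₂ (inj₁ e) = inj₂ e
  ... | inj₂ (inj₂ m) = inj₁ (inj₁ (Next-++⁺ʳ (s ∷ as) (there m)))

  rotate-↭ : ∀ (as : List V) {s′ v : V} {bs} → s′ ∷ (as ʳ++ v ∷ bs) ↭ as ++ s′ ∷ v ∷ bs
  rotate-↭ as {s′} {v} {bs} = ↭-trans
    (prep s′ (subst (_↭ as ++ v ∷ bs) (≡-sym (ʳ++-defn as)) (++⁺ʳ (v ∷ bs) (↭-reverse as))))
    (↭-sym (shift s′ as (v ∷ bs)))

  Rotated-rotate : ∀ {P S s q s′ v} as {bs} → Rotated P S (s , q) → s ∈ S →
    s ∷ q ≡ as ++ s′ ∷ v ∷ bs → s ~ v → Rotated P (s′ ∷ S) (s′ , as ʳ++ v ∷ bs)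
  Rotated-rotate {s′ = s′} {v} as {bs} r s∈S eq s~v .perm =
    ↭-trans (subst (s′ ∷ (as ʳ++ v ∷ bs) ↭_) (≡-sym eq) (rotate-↭ as)) (r .perm)
  Rotated-rotate as r s∈S eq s~v .path n with Next-rotate as eq n
  ... | inj₁ a             = Adjacent⇒~ (r .path) a
  ... | inj₂ (refl , refl) = s~v
  Rotated-rotate {P} {S} {s} {q} {s′} {v} as {bs} r s∈S eq s~v .old {u} {w} a = go (classify a)
    where
    classify : Adjacent (s′ ∷ (as ʳ++ v ∷ bs)) u w →
      Adjacent (s ∷ q) u w ⊎ (u ≡ s × w ≡ v) ⊎ (w ≡ s × u ≡ v)
    classify (inj₁ n) = Sum.map₂ inj₁ (Next-rotate as eq n)
    classify (inj₂ n) = Sum.map swap inj₂ (Next-rotate as eq n)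
    pivot : Adjacent (s ∷ q) v s′
    pivot = inj₂ (subst (λ xs → Next xs s′ v) (≡-sym eq) (split⇒Next as))
    go : Adjacent (s ∷ q) u w ⊎ (u ≡ s × w ≡ v) ⊎ (w ≡ s × u ≡ v) → Adjacent P u w ⊎ Touched P (s′ ∷ S) u
    go (inj₁ b)                    = Rotated-weaken r .old b
    go (inj₂ (inj₁ (refl , refl))) = inj₂ (inj₁ (there s∈S))
    -- The pivot `v` gains `s` in exchange for `s′`. Either the lost edge belonged to `P`, and then
    -- `v` is beside the new end `s′` on `P`, or `v` was touched already.
    go (inj₂ (inj₂ (refl , refl))) with Rotated-weaken r .old pivot
    ... | inj₁ b = inj₂ (inj₂ (s′ , here refl , swap b))
    ... | inj₂ t = inj₂ t
  -- The pivot is adjacent to the end `s`, so it is not in `fs`; the reversed segment therefore lies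
  -- in front of the fixed tail.
  Rotated-rotate {s = s} {s′ = s′} {v} as {bs} r s∈S eq s~v .fixed ms eqP free
    with r .fixed ms eqP (free ∘ there)
  ... | ms′ , eq′ with suffix-split (as ++ [ s′ ]) ms′ (λ v∈fs → free (there s∈S) v∈fs s~v)
                         (trans (++-assoc as [ s′ ] (v ∷ bs)) (trans (≡-sym eq) eq′))
  ...   | ms″ , eq″ = s′ ∷ (as ʳ++ ms″) ,
    cong (s′ ∷_) (trans (cong (as ʳ++_) eq″) (ʳ++-++ as))

  rotated : ∀ {P T} → IsPath P → Rotations P T → All (Rotated P (ends T)) T
  rotated pathP (start refl) = record
    { perm = ↭-refl ; path = pathP ; old = inj₁ ; fixed = λ ms eq _ → ms , eq } ∷ []
  rotated pathP (rotate as rs Q∈T eq s~v _) =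
    Rotated-rotate as (All.lookup (rotated pathP rs) Q∈T) (∈-map⁺ proj₁ Q∈T) eq s~v
    ∷ All.map Rotated-weaken (rotated pathP rs)

  Unique-ends : ∀ {P T} → Rotations P T → Unique (ends T)
  Unique-ends (start _)                = [] ∷ []
  Unique-ends (rotate _ rs _ _ _ s′∉T) =
    All.tabulate (λ { x∈T refl → s′∉T x∈T }) ∷ Unique-ends rs

  ends⊆ : ∀ {P T} → IsPath P → Rotations P T → ends T ⊆ P
  ends⊆ pathP rs s∈S with ∈-map⁻ proj₁ s∈S
  ... | Q , Q∈T , refl = ∈-resp-↭ (All.lookup (rotated pathP rs) Q∈T .perm) (here refl)

  ends-nonempty : ∀ {P T} → Rotations P T → 1 ≤ length (ends T)
  ends-nonempty (start _)            = s≤s z≤n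
  ends-nonempty (rotate _ _ _ _ _ _) = s≤s z≤n

  -- Ends are added one at a time, so some earlier moment has exactly `a` of them, and it is again a
  -- valid sequence of rotations of `P`.
  stage : ∀ {P T} a → 1 ≤ a → a ≤ length (ends T) → Rotations P T →
    ∃ λ T′ → Rotations P T′ × length (ends T′) ≡ a × T′ ⊆ T
  stage a 1≤a a≤ (start eq) = _ , start eq , ≤-antisym 1≤a a≤ , id
  stage {T = T} a 1≤a a≤ rs@(rotate _ rs′ _ _ _ _) with m≤n⇒m<n∨m≡n a≤
  ... | inj₂ refl       = T , rs , refl , id
  ... | inj₁ (s≤s a≤′) with stage a 1≤a a≤′ rs′
  ...   | T′ , rs″ , len , T′⊆T = T′ , rs″ , len , there ∘ T′⊆T

  -- `S` is separate from the ends of `T` because an early stage is closed only relative to the ends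
  -- of the full sequence.
  Closed : List V → List End → Set
  Closed S T = ∀ {s q u v} → (s , q) ∈ T → Next (s ∷ q) u v → s ~ v → u ∈ S

  -- A vertex that is not an end of T can have lost or gained path neighbours only as a
  -- pivot, and then it was beside an end of T on P.
  posa : ∀ {P S T v z} → IsPath P → Rotations P T → ends T ⊆ S → Closed S T →
    z ∈ ends T → v ∉ ends T → v ∈ P → z ~ v → ∃[ s ] s ∈ S × Adjacent P s v
  posa {P} {S} {T} {v} pathP rs T⊆S closed z∈T v∉T v∈P z~v with ∈-map⁻ proj₁ z∈T
  ... | (z , q) , Q∈T , refl = go (∈-resp-↭ (↭-sym (r .perm)) v∈P)
    where
    r : Rotated P (ends T) (z , q)
    r = All.lookup (rotated pathP rs) Q∈T
    go : v ∈ z ∷ q → ∃[ s ] s ∈ S × Adjacent P s v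
    go (here refl) = contradiction z∈T v∉T
    go (there v∈q) with predecessor v∈q
    -- Rotating at `v` would make its predecessor `s` an end, so closedness puts `s` into `S`.
    ... | s , n with r .old (inj₂ n)
    ...   | inj₁ a                     = s , closed Q∈T n z~v , swap a
    ...   | inj₂ (inj₁ v∈T)            = contradiction v∈T v∉T
    ...   | inj₂ (inj₂ (t , t∈T , a)) = t , T⊆S t∈T , a

  -- Maximal paths and the cycles they close.

  record Maximal (U P : List V) (T : List End) : Set where
    field
      isPath    : IsPath P
      unique    : Unique P
      inside    : P ⊆ U
      rotations : Rotations P T
      closed    : Closed (ends T) T
      confined  : ∀ {s v} → s ∈ ends T → v ∈ U → s ~ v → v ∈ P

  data Progress (U P : List V) (T : List End) : Set where
    extension : ∀ {s q v} → (s , q) ∈ T → v ∈ U → v ∉ P → s ~ v → Progress U P T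
    rotation  : ∀ {s q u v} → (s , q) ∈ T → Next (s ∷ q) u v → s ~ v → u ∉ ends T → Progress U P T
    stuck     : Closed (ends T) T → (∀ {s v} → s ∈ ends T → v ∈ U → s ~ v → v ∈ P) → Progress U P T

  progress : ∀ U P T → Progress U P T
  progress U P T with any? (λ Q → any? (λ v → (proj₁ Q ~? v) ×-dec (v ∉? P)) U) T
  ... | yes ext with find ext
  ...   | Q , Q∈T , ext′ with find ext′
  ...     | v , v∈U , s~v , v∉P = extension Q∈T v∈U v∉P s~v
  progress U P T | no ¬ext
    with any? (λ Q → anyNext? (λ u v → (proj₁ Q ~? v) ×-dec (u ∉? ends T)) (vertices Q)) T
  ... | yes rot with find rot
  ...   | Q , Q∈T , u , v , n , s~v , u∉T = rotation Q∈T n s~v u∉T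
  progress U P T | no ¬ext | no ¬rot = stuck closed confined
    where
    closed : Closed (ends T) T
    closed {u = u} {v} Q∈T n s~v with u ∈? ends T
    ... | yes u∈T = u∈T
    ... | no  u∉T = contradiction (lose Q∈T (u , v , n , s~v , u∉T)) ¬rot
    confined : ∀ {s v} → s ∈ ends T → v ∈ U → s ~ v → v ∈ P
    confined {s} {v} s∈T v∈U s~v with v ∈? P | ∈-map⁻ proj₁ s∈T
    ... | yes v∈P | _ = v∈P
    ... | no  v∉P | Q , Q∈T , refl = contradiction (lose Q∈T (lose v∈U (s~v , v∉P))) ¬ext

  -- The ends are distinct vertices of `P`, which bounds the number of rotations and hence the
  -- `fuel`.
  maximal-or-longer : ∀ {U P T} fuel → IsPath P → Unique P → P ⊆ U → Rotations P T →
    length P < length (ends T) + fuel →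
    (∃ λ T′ → Maximal U P T′) ⊎
    (∃[ e ] ∃[ p ] IsPath (e ∷ p) × Unique (e ∷ p) × e ∷ p ⊆ U × length (e ∷ p) ≡ suc (length P))
  maximal-or-longer {U} {P} {T} fuel pathP uniqP P⊆U rs bound with progress U P T
  ... | stuck closed confined = inj₁ (T , record
    { isPath = pathP ; unique = uniqP ; inside = P⊆U ; rotations = rs
    ; closed = closed ; confined = confined })
  ... | extension {s} {q} {v} Q∈T v∈U v∉P s~v = inj₂ (v , s ∷ q , path′ , unique′ , inside′ , cong suc (↭-length (r .perm)))
    where
    r : Rotated P (ends T) (s , q)
    r = All.lookup (rotated pathP rs) Q∈T
    path′ : IsPath (v ∷ s ∷ q)
    path′ here      = ~-sym s~v
    path′ (there n) = r .path n
    unique′ : Unique (v ∷ s ∷ q)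
    unique′ = All.tabulate (λ { x∈Q refl → v∉P (∈-resp-↭ (r .perm) x∈Q) })
      ∷ Unique-resp-↭ (↭-sym (r .perm)) uniqP
    inside′ : v ∷ s ∷ q ⊆ U
    inside′ (here refl) = v∈U
    inside′ (there x∈Q) = P⊆U (∈-resp-↭ (r .perm) x∈Q)
  maximal-or-longer {T = T} zero pathP uniqP P⊆U rs bound | rotation _ _ _ _ =
    contradiction (Unique-⊆⇒length≤ (Unique-ends rs) (ends⊆ pathP rs))
      (<⇒≱ (subst (_ <_) (+-identityʳ _) bound))
  maximal-or-longer {P = P} {T} (suc fuel) pathP uniqP P⊆U rs bound | rotation Q∈T n s~v u∉T
    with Next⇒split n
  ... | as , bs , eq = maximal-or-longer fuel pathP uniqP P⊆U (rotate as rs Q∈T eq s~v u∉T)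
    (subst (length P <_) (+-suc (length (ends T)) fuel) bound)

  -- `Maximal` takes the place of a longest path: neither a new end nor an extension is available.
  -- Each failure lengthens the path, which can happen only boundedly often inside `U`.
  maximal : ∀ {U} fuel e p → IsPath (e ∷ p) → Unique (e ∷ p) → e ∷ p ⊆ U →
    length U < length (e ∷ p) + fuel → ∃₂ λ P T → Maximal U P T
  maximal {U} fuel e p pathP uniqP P⊆U bound
    with maximal-or-longer (length (e ∷ p)) pathP uniqP P⊆U (start refl) ≤-refl
  ... | inj₁ (T , m) = e ∷ p , T , m
  maximal {U} zero e p pathP uniqP P⊆U bound | inj₂ _ =
    contradiction (Unique-⊆⇒length≤ uniqP P⊆U) (<⇒≱ (subst (length U <_) (+-identityʳ _) bound))
  maximal {U} (suc fuel) e p pathP uniqP P⊆U bound | inj₂ (e′ , p′ , path′ , uniq′ , sub′ , len) =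
    maximal fuel e′ p′ path′ uniq′ sub′ (begin-strict
      length U                        <⟨ bound ⟩
      length (e ∷ p) + suc fuel       ≡⟨ +-suc _ fuel ⟩
      suc (length (e ∷ p)) + fuel     ≡⟨ cong (_+ fuel) len ⟨
      length (e′ ∷ p′) + fuel         ∎)
    where open ≤-Reasoning

  -- The cycle may degenerate to the single vertex v.
  Closes : List V → V → Set
  Closes ms v = ms ≡ [] ⊎ (∃₂ λ s ms′ → ms ≡ s ∷ ms′ × s ~ v)

  LongCycle : ℕ → Set
  LongCycle n = ∃₂ λ ms v →
    n ≤ length (ms ++ [ v ]) × Unique (ms ++ [ v ]) × IsPath (ms ++ [ v ]) × Closes ms v

  -- The vertex v of P farthest from the active end that is adjacent to some end closes
  -- the cycle.
  posa-cycle : ∀ {P T} → IsPath P → Unique P → Rotations P T →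
    ∃₂ λ ms v → Unique (ms ++ [ v ]) × IsPath (ms ++ [ v ]) × Closes ms v ×
      (∀ {u} → u ∈ P → u ∈ ends T ⊎ Any (_~ u) (ends T) → u ∈ ms ++ [ v ])
  posa-cycle {[]} pathP uniqP rs = contradiction
    (≤-trans (ends-nonempty rs) (Unique-⊆⇒length≤ (Unique-ends rs) (ends⊆ pathP rs))) λ ()
  posa-cycle {e ∷ p} {T} pathP uniqP rs with splitLast (λ u → any? (_~? u) (ends T)) e p
  ... | ms , v , fs , eq , free , d = close d
    where
    P = e ∷ p
    rot : ∀ {s} → s ∈ ends T → ∃ λ q → Rotated P (ends T) (s , q)
    rot s∈T with ∈-map⁻ proj₁ s∈T
    ... | (s , q) , Q∈T , refl = q , All.lookup (rotated pathP rs) Q∈T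
    tail-fixed : ∀ {Q} → Rotated P (ends T) Q → ∃ λ ms′ → vertices Q ≡ ms′ ++ v ∷ fs
    tail-fixed r = r .fixed ms eq (λ s∈T w∈fs s~w → free w∈fs (lose s∈T s~w))
    avoids : ∀ {u} → u ∈ ends T ⊎ Any (_~ u) (ends T) → u ∉ fs
    avoids (inj₂ a)   u∈fs = free u∈fs a
    -- An end heads its own rotated path, which still finishes with `v ∷ fs`; as no vertex repeats,
    -- the end is not in `fs`.
    avoids (inj₁ u∈T) u∈fs with rot u∈T
    ... | q , r with tail-fixed r
    ...   | ms′ , eq′ with subst Unique eq′ (Unique-resp-↭ (↭-sym (r .perm)) uniqP)
    avoids (inj₁ u∈T) u∈fs | q , r | [] , refl | uq =
      contradiction u∈fs (Unique.Unique[x∷xs]⇒x∉xs uq)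
    avoids (inj₁ u∈T) u∈fs | q , r | m ∷ ms′ , refl | uq =
      contradiction (there u∈fs) (Unique-++⇒disjoint (m ∷ ms′) uq (here refl))
    regroup : ∀ (ms′ : List V) → ms′ ++ v ∷ fs ≡ (ms′ ++ [ v ]) ++ fs
    regroup ms′ = ≡-sym (++-assoc ms′ [ v ] fs)
    build : ∀ ms′ {Q} → Q ↭ P → IsPath Q → Q ≡ ms′ ++ v ∷ fs → Closes ms′ v →
      ∃₂ λ ms v → Unique (ms ++ [ v ]) × IsPath (ms ++ [ v ]) × Closes ms v ×
        (∀ {u} → u ∈ P → u ∈ ends T ⊎ Any (_~ u) (ends T) → u ∈ ms ++ [ v ])
    build ms′ Q↭P pathQ eq′ cl = ms′ , v ,
      Unique-++⁻ˡ (ms′ ++ [ v ]) (subst Unique eq″ (Unique-resp-↭ (↭-sym Q↭P) uniqP)) ,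
      (λ {u} {w} n → pathQ (subst (λ xs → Next xs u w) (≡-sym eq″) (Next-++⁺ˡ n))) ,
      cl ,
      covers
      where
      eq″ = trans eq′ (regroup ms′)
      covers : ∀ {u} → u ∈ P → u ∈ ends T ⊎ Any (_~ u) (ends T) → u ∈ ms′ ++ [ v ]
      covers {u} u∈P near with ∈-++⁻ (ms′ ++ [ v ]) (subst (u ∈_) eq″ (∈-resp-↭ (↭-sym Q↭P) u∈P))
      ... | inj₁ u∈   = u∈
      ... | inj₂ u∈fs = contradiction u∈fs (avoids near)
    close : Any (_~ v) (ends T) ⊎ ms ≡ [] → _
    close (inj₂ refl) = build [] ↭-refl pathP eq (inj₁ refl)
    -- The path starting at an end `s` adjacent to `v` still runs into `v` just before the tail;
    -- cutting the tail off and adding the edge between `s` and `v` closes the cycle.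
    close (inj₁ a) with find a
    ... | s , s∈T , s~v with rot s∈T
    ...   | q , r with tail-fixed r
    ...     | [] , eq′      = build [] (r .perm) (r .path) eq′ (inj₁ refl)
    ...     | m ∷ ms′ , eq′ = build (m ∷ ms′) (r .perm) (r .path) eq′
      (inj₂ (m , ms′ , refl , subst (_~ v) (∷-injectiveˡ eq′) s~v))

  -- Expansion forces a long cycle.

  Near : List V → V → Set
  Near Z u = Any (λ z → z ≡ u ⊎ z ~ u) Z

  near? : ∀ Z u → Dec (Near Z u)
  near? Z u = any? (λ z → (z ≟ u) ⊎-dec (z ~? u)) Z

  Γ : List V → List V → List V
  Γ U Z = filter (near? Z) U

  Outer : List V → V → Set
  Outer X u = Any (_~ u) X × u ∉ X

  outer? : ∀ X u → Dec (Outer X u)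
  outer? X u = any? (_~? u) X ×-dec (u ∉? X)

  ∂ : List V → List V → List V
  ∂ U X = filter (outer? X) U

  -- Expansion is assumed up to `Goal`, the outcome wanted when a set fails to expand. In the
  -- application `a` and `b` are the sizes of the two smallest parts.
  module _ {Goal : Set} {U : List V} (uniqU : Unique U) {n a b : ℕ} (1≤a : 1 ≤ a) (large : 3 * b + 5 * a ≤ n) (a≤U : a ≤ length U)
    (expandₐ : ∀ Z → Unique Z → Z ⊆ U → a ≤ length Z → Goal ⊎ n + a ≤ length (Γ U Z) + b)
    (expandᵦ : ∀ Z → Unique Z → Z ⊆ U → b ≤ length Z → Goal ⊎ n ≤ length (Γ U Z)) where

    -- From `x + s ≤ 2 * a - 2` follows `g ≤ 6 * a - 6`, while `large` and the growth give
    -- `g ≥ 6 * a + 2 * b`.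
    joint-growth-absurd : ∀ {x s g} → x < a → s < a → g ≤ (x + s) + (2 * x + 2 * s) → ¬ n + a ≤ g + b
    joint-growth-absurd {x} {s} {g} x<a s<a g≤ n+a≤ = <-irrefl refl (begin-strict
      b + 6 * a                          ≤⟨ m≤m+n _ (2 * b) ⟩
      b + 6 * a + 2 * b                  ≡⟨ eq₁ a b ⟩
      3 * b + 5 * a + a                  ≤⟨ +-monoˡ-≤ a large ⟩
      n + a                              ≤⟨ n+a≤ ⟩
      g + b                              ≤⟨ +-monoˡ-≤ b g≤ ⟩
      (x + s) + (2 * x + 2 * s) + b      <⟨ m<m+n _ {6} (s≤s z≤n) ⟩
      (x + s) + (2 * x + 2 * s) + b + 6  ≡⟨ eq₂ x s b ⟩
      b + 3 * (suc x + suc s)            ≤⟨ +-monoʳ-≤ b (*-monoʳ-≤ 3 (+-mono-≤ x<a s<a)) ⟩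
      b + 3 * (a + a)                    ≡⟨ eq₃ a b ⟩
      b + 6 * a                          ∎)
      where
      open ≤-Reasoning
      eq₁ : ∀ a b → b + 6 * a + 2 * b ≡ 3 * b + 5 * a + a
      eq₁ = solve-∀
      eq₂ : ∀ x s b → (x + s) + (2 * x + 2 * s) + b + 6 ≡ b + 3 * ((1 + x) + (1 + s))
      eq₂ = solve-∀
      eq₃ : ∀ a b → b + 3 * (a + a) ≡ b + 6 * a
      eq₃ = solve-∀

    -- The growth gives `2 * s ≥ n - b - x ≥ 2 * b + 5 * a - x`, and `x < a` makes this at least
    -- `2 * b + 4 * x`.
    growth⇒many-ends : ∀ {x s g} → x < a → g ≤ a + (x + 2 * s) → n + a ≤ g + b → b + 2 * x ≤ s
    growth⇒many-ends {x} {s} {g} x<a g≤ n+a≤ = *-cancelˡ-≤ 2 (+-cancelʳ-≤ (a + x + b) _ _ (begin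
      2 * (b + 2 * x) + (a + x + b)  ≡⟨ eq₁ a b x ⟩
      3 * b + 5 * x + a              ≤⟨ +-monoˡ-≤ a (+-monoʳ-≤ (3 * b) (*-monoʳ-≤ 5 (<⇒≤ x<a))) ⟩
      3 * b + 5 * a + a              ≤⟨ +-monoˡ-≤ a large ⟩
      n + a                          ≤⟨ n+a≤ ⟩
      g + b                          ≤⟨ +-monoˡ-≤ b g≤ ⟩
      a + (x + 2 * s) + b            ≡⟨ eq₂ a b x s ⟩
      2 * s + (a + x + b)            ∎))
      where
      open ≤-Reasoning
      eq₁ : ∀ a b x → 2 * (b + 2 * x) + (a + x + b) ≡ 3 * b + 5 * x + a
      eq₁ = solve-∀
      eq₂ : ∀ a b x s → a + (x + 2 * s) + b ≡ 2 * s + (a + x + b)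
      eq₂ = solve-∀

    record Removable (X : List V) : Set where
      field
        distinct : Unique X
        within   : X ⊆ U
        small    : length X < a
        sparse   : length (∂ U X) ≤ 2 * length X
    open Removable

    outside : ∀ {X} → Removable X → ∃[ e ] e ∈ U × e ∉ X
    outside {X} rem with any? (_∉? X) U
    ... | yes p = find p
    ... | no ¬p = contradiction (≤-trans a≤U (Unique-⊆⇒length≤ uniqU U⊆X)) (<⇒≱ (rem .small))
      where
      U⊆X : U ⊆ X
      U⊆X {u} u∈U with u ∈? X
      ... | yes u∈X = u∈X
      ... | no  u∉X = contradiction (lose u∈U u∉X) ¬p

    module _ {X P T} (rem : Removable X) (m : Maximal (filter (_∉? X) U) P T) where
      open Maximal m

      S : List V
      S = ends T

      S⊆P : S ⊆ P
      S⊆P = ends⊆ isPath rotations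

      S⊆U : S ⊆ U
      S⊆U s∈S = proj₁ (∈-filter⁻ (_∉? X) (inside (S⊆P s∈S)))

      S∩X : ∀ {s} → s ∈ S → s ∉ X
      S∩X s∈S = proj₂ (∈-filter⁻ (_∉? X) {xs = U} (inside (S⊆P s∈S)))

      sides : List V
      sides = besides _≟_ P S

      reaches : ∀ {s v} → s ∈ S → v ∈ U → v ∉ X → s ~ v → v ∈ P
      reaches s∈S v∈U v∉X = confined s∈S (∈-filter⁺ (_∉? X) v∈U v∉X)

      ends-⊆ : ∀ {T′} → T′ ⊆ T → ends T′ ⊆ S
      ends-⊆ T′⊆T s∈ with ∈-map⁻ proj₁ s∈
      ... | Q , Q∈ , refl = ∈-map⁺ proj₁ (T′⊆T Q∈)

      -- `confined` keeps `v` on `P`, and `posa` then finds it beside an end of the full sequence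
      -- `T`, not necessarily of the stage `T′`.
      stage-sides : ∀ {T′ z v} → Rotations P T′ → T′ ⊆ T → z ∈ ends T′ → v ∈ U → v ∉ X →
        v ∉ ends T′ → z ~ v → v ∈ sides
      stage-sides rs T′⊆T z∈ v∈U v∉X v∉ z~v
        with posa isPath rs (ends-⊆ T′⊆T) (closed ∘ T′⊆T) z∈ v∉ (reaches (ends-⊆ T′⊆T z∈) v∈U v∉X z~v) z~v
      ... | s , s∈S , adj = ∈-besides _≟_ unique s∈S adj

      -- Only the first `a` ends are expanded: they contribute just `a` to their closed
      -- neighbourhood instead of `length S`, while their other neighbours still lie in `X` or
      -- `sides`.
      ends-large : a ≤ length S → Goal ⊎ b + 2 * length X ≤ length S
      ends-large a≤S with stage a 1≤a a≤S rotations
      ... | T′ , rs , len , T′⊆T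
        with expandₐ (ends T′) (Unique-ends rs) (S⊆U ∘ ends-⊆ T′⊆T) (≤-reflexive (≡-sym len))
      ...   | inj₁ goal = inj₁ goal
      ...   | inj₂ grow = inj₂ (growth⇒many-ends (rem .small) ΓZ≤ grow)
        where
        Z = ends T′
        ΓZ⊆ : Γ U Z ⊆ Z ++ (X ++ sides)
        ΓZ⊆ {u} u∈ with ∈-filter⁻ (near? Z) {xs = U} u∈ | u ∈? Z | u ∈? X
        ... | _         | yes u∈Z | _       = ∈-++⁺ˡ u∈Z
        ... | _         | no _    | yes u∈X = ∈-++⁺ʳ Z (∈-++⁺ˡ u∈X)
        ... | u∈U , nbr | no u∉Z  | no u∉X  with find nbr
        ...   | z , z∈Z , inj₁ refl = contradiction z∈Z u∉Z
        ...   | z , z∈Z , inj₂ z~u  = ∈-++⁺ʳ Z (∈-++⁺ʳ X (stage-sides rs T′⊆T z∈Z u∈U u∉X u∉Z z~u))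
        ΓZ≤ : length (Γ U Z) ≤ a + (length X + 2 * length S)
        ΓZ≤ = begin
          length (Γ U Z)                           ≤⟨ Unique-⊆⇒length≤ (Unique.filter⁺ (near? Z) uniqU) ΓZ⊆ ⟩
          length (Z ++ (X ++ sides))               ≡⟨ length-++ Z ⟩
          length Z + length (X ++ sides)           ≡⟨ cong (length Z +_) (length-++ X) ⟩
          length Z + (length X + length sides)     ≤⟨ +-mono-≤ (≤-reflexive len) (+-monoʳ-≤ (length X) (length-besides _≟_ P S)) ⟩
          a + (length X + 2 * length S)            ∎
          where open ≤-Reasoning

      W? : ∀ v → Dec (v ∉ ∂ U X)
      W? = _∉? ∂ U X

      W : List V
      W = filter W? S

      W⊆S : W ⊆ S
      W⊆S w∈ = proj₁ (∈-filter⁻ W? w∈)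

      S⊆W++∂ : S ⊆ W ++ ∂ U X
      S⊆W++∂ {s} s∈S with s ∈? ∂ U X
      ... | yes s∈∂ = ∈-++⁺ʳ W s∈∂
      ... | no  s∉∂ = ∈-++⁺ˡ (∈-filter⁺ W? s∈S s∉∂)

      -- An end in `∂ U X` is one with a neighbour in `X`. By `sparse` there are at most
      -- `2 * length X` of these, and the surplus in the hypothesis pays for them.
      b≤W : b + 2 * length X ≤ length S → b ≤ length W
      b≤W b+2x≤s = +-cancelʳ-≤ (2 * length X) b (length W) (begin
        b + 2 * length X              ≤⟨ b+2x≤s ⟩
        length S                      ≤⟨ Unique-⊆⇒length≤ (Unique-ends rotations) S⊆W++∂ ⟩
        length (W ++ ∂ U X)           ≡⟨ length-++ W ⟩
        length W + length (∂ U X)     ≤⟨ +-monoʳ-≤ (length W) (rem .sparse) ⟩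
        length W + 2 * length X       ∎)
        where open ≤-Reasoning

      finish : b + 2 * length X ≤ length S → Goal ⊎ LongCycle n
      finish b+2x≤s with expandᵦ W (Unique.filter⁺ W? (Unique-ends rotations)) (S⊆U ∘ W⊆S) (b≤W b+2x≤s)
        | posa-cycle isPath unique rotations
      ... | inj₁ goal | _ = inj₁ goal
      ... | inj₂ n≤ΓW | ms , v , uniq , path , closes , covers =
        inj₂ (ms , v , ≤-trans n≤ΓW (Unique-⊆⇒length≤ (Unique.filter⁺ (near? W) uniqU) ΓW⊆) , uniq , path , closes)
        where
        ΓW⊆ : Γ U W ⊆ ms ++ [ v ]
        ΓW⊆ {u} u∈ with ∈-filter⁻ (near? W) {xs = U} u∈
        ... | u∈U , nbr with find nbr
        ...   | w , w∈W , hit with ∈-filter⁻ W? {xs = S} w∈W | hit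
        ...     | w∈S , _   | inj₁ refl = covers (S⊆P w∈S) (inj₁ w∈S)
        ...     | w∈S , w∉∂ | inj₂ w~u  = covers (reaches w∈S u∈U u∉X w~u) (inj₂ (lose w∈S w~u))
          where
          u∉X : u ∉ X
          -- A neighbour in `X` would make `w` an outer neighbour of `X`.
          u∉X u∈X = w∉∂ (∈-filter⁺ (outer? X) (S⊆U w∈S) (lose u∈X (~-sym w~u) , S∩X w∈S))

      -- Outer neighbours of `X ++ S` are outer neighbours of `X` or beside `S` on `P`, so two
      -- bounds with factor 2 add up to the new `sparse`. They also cap the closed neighbourhood at
      -- three times the size, which rules out `a` or more vertices unless `Goal` holds.
      enlarged : length S < a → Goal ⊎ Removable (X ++ S)
      enlarged s<a = case a ≤? length (X ++ S) of λ where
          (no  a≰) → inj₂ record { distinct = uniqY ; within = Y⊆U ; small = ≰⇒> a≰ ; sparse = ∂Y≤2Y }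
          (yes a≤) → case expandₐ (X ++ S) uniqY Y⊆U a≤ of λ where
            (inj₁ goal) → inj₁ goal
            (inj₂ grow) → contradiction grow (joint-growth-absurd (rem .small) s<a ΓY≤)
        where
        open ≤-Reasoning
        Y = X ++ S
        uniqY : Unique Y
        uniqY = Unique.++⁺ (rem .distinct) (Unique-ends rotations) λ (x∈X , x∈S) → S∩X x∈S x∈X
        Y⊆U : Y ⊆ U
        Y⊆U y∈ with ∈-++⁻ X y∈
        ... | inj₁ y∈X = rem .within y∈X
        ... | inj₂ y∈S = S⊆U y∈S
        classify : ∀ {u y} → u ∈ U → y ∈ Y → y ~ u → u ∉ Y → u ∈ ∂ U X ++ sides
        classify {u} u∈U y∈Y y~u u∉Y with ∈-++⁻ X y∈Y
        ... | inj₁ y∈X = ∈-++⁺ˡ (∈-filter⁺ (outer? X) u∈U (lose y∈X y~u , u∉Y ∘ ∈-++⁺ˡ))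
        ... | inj₂ y∈S = ∈-++⁺ʳ (∂ U X) (stage-sides rotations id y∈S u∈U (u∉Y ∘ ∈-++⁺ˡ) (u∉Y ∘ ∈-++⁺ʳ X) y~u)
        ∂X++sides≤ : length (∂ U X ++ sides) ≤ 2 * length X + 2 * length S
        ∂X++sides≤ = begin
          length (∂ U X ++ sides)           ≡⟨ length-++ (∂ U X) ⟩
          length (∂ U X) + length sides     ≤⟨ +-mono-≤ (rem .sparse) (length-besides _≟_ P S) ⟩
          2 * length X + 2 * length S       ∎
        ∂Y⊆ : ∂ U Y ⊆ ∂ U X ++ sides
        ∂Y⊆ u∈ with ∈-filter⁻ (outer? Y) {xs = U} u∈
        ... | u∈U , hit , u∉Y with find hit
        ...   | y , y∈Y , y~u = classify u∈U y∈Y y~u u∉Y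
        ∂Y≤2Y : length (∂ U Y) ≤ 2 * length Y
        ∂Y≤2Y = begin
          length (∂ U Y)                 ≤⟨ Unique-⊆⇒length≤ (Unique.filter⁺ (outer? Y) uniqU) ∂Y⊆ ⟩
          length (∂ U X ++ sides)        ≤⟨ ∂X++sides≤ ⟩
          2 * length X + 2 * length S    ≡⟨ *-distribˡ-+ 2 (length X) (length S) ⟨
          2 * (length X + length S)      ≡⟨ cong (2 *_) (length-++ X) ⟨
          2 * length Y                   ∎
        ΓY⊆ : Γ U Y ⊆ Y ++ (∂ U X ++ sides)
        ΓY⊆ {u} u∈ with ∈-filter⁻ (near? Y) {xs = U} u∈ | u ∈? Y
        ... | _         | yes u∈Y = ∈-++⁺ˡ u∈Y
        ... | u∈U , nbr | no u∉Y  with find nbr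
        ...   | y , y∈Y , inj₁ refl = contradiction y∈Y u∉Y
        ...   | y , y∈Y , inj₂ y~u  = ∈-++⁺ʳ Y (classify u∈U y∈Y y~u u∉Y)
        ΓY≤ : length (Γ U Y) ≤ (length X + length S) + (2 * length X + 2 * length S)
        ΓY≤ = begin
          length (Γ U Y)                         ≤⟨ Unique-⊆⇒length≤ (Unique.filter⁺ (near? Y) uniqU) ΓY⊆ ⟩
          length (Y ++ (∂ U X ++ sides))         ≡⟨ length-++ Y ⟩
          length Y + length (∂ U X ++ sides)     ≤⟨ +-mono-≤ (≤-reflexive (length-++ X)) ∂X++sides≤ ⟩
          (length X + length S) + (2 * length X + 2 * length S) ∎

    -- Every round adds at least one end to `X`, and `X` never reaches size `a`, so the `fuel`
    -- cannot run out.
    search : ∀ fuel X → Removable X → a ≤ length X + fuel → Goal ⊎ LongCycle n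
    search zero X rem bound = contradiction (subst (a ≤_) (+-identityʳ _) bound) (<⇒≱ (rem .small))
    search (suc fuel) X rem bound with outside rem
    ... | e , e∈U , e∉X
      with maximal (length (filter (_∉? X) U)) e [] (λ { (there ()) }) ([] ∷ [])
             (λ { (here refl) → ∈-filter⁺ (_∉? X) e∈U e∉X }) ≤-refl
    ...   | P , T , m with a ≤? length (ends T)
    ...     | yes a≤S with ends-large rem m a≤S
    ...       | inj₁ goal = inj₁ goal
    ...       | inj₂ large-S = finish rem m large-S
    search (suc fuel) X rem bound | e , e∈U , e∉X | P , T , m | no a≰S with enlarged rem m (≰⇒> a≰S)
    ... | inj₁ goal = inj₁ goal
    ... | inj₂ rem′ = search fuel (X ++ ends T) rem′ (begin
      a                                         ≤⟨ bound ⟩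
      length X + suc fuel                       ≡⟨ +-assoc (length X) 1 fuel ⟨
      length X + 1 + fuel                       ≤⟨ +-monoˡ-≤ fuel (+-monoʳ-≤ (length X) (ends-nonempty (Maximal.rotations m))) ⟩
      length X + length (ends T) + fuel         ≡⟨ cong (_+ fuel) (length-++ X) ⟨
      length (X ++ ends T) + fuel               ∎)
      where open ≤-Reasoning

    expanding⇒long-cycle : Goal ⊎ LongCycle n
    expanding⇒long-cycle = search a [] record
      { distinct = [] ; within = λ () ; small = 1≤a ; sparse = ∂[]≤ } ≤-refl
      where
      ∂[]≤ : length (∂ U []) ≤ 0
      ∂[]≤ = Unique-⊆⇒length≤ {ys = []} (Unique.filter⁺ (outer? []) uniqU) λ u∈ →
        contradiction (proj₁ (proj₂ (∈-filter⁻ (outer? []) {xs = U} u∈))) λ ()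

-- From lists to indexed vertices; colours.

lookup-injective : ∀ {xs : List V} → Unique xs → ∀ {i j} → lookup xs i ≡ lookup xs j → i ≡ j
lookup-injective {xs = x ∷ xs} (x≢ ∷ uniq) {zero}  {zero}  eq = refl
lookup-injective {xs = x ∷ xs} (x≢ ∷ uniq) {zero}  {suc j} eq = contradiction eq (All.lookup x≢ (∈-lookup j))
lookup-injective {xs = x ∷ xs} (x≢ ∷ uniq) {suc i} {zero}  eq = contradiction (≡-sym eq) (All.lookup x≢ (∈-lookup i))
lookup-injective {xs = x ∷ xs} (x≢ ∷ uniq) {suc i} {suc j} eq = cong suc (lookup-injective uniq eq)

lookup-Next : ∀ (x : V) xs (i : Fin (length xs)) → Next (x ∷ xs) (lookup (x ∷ xs) (inject₁ i)) (lookup xs i)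
lookup-Next x (y ∷ xs) zero    = here
lookup-Next x (y ∷ xs) (suc i) = there (lookup-Next y xs i)

lookup-last : ∀ (x : V) xs v → lookup (x ∷ xs ++ [ v ]) (fromℕ (length (xs ++ [ v ]))) ≡ v
lookup-last x []       v = refl
lookup-last x (y ∷ xs) v = lookup-last y xs v

_≟ᶜ_ : DecidableEquality Colour
red  ≟ᶜ red  = yes refl
red  ≟ᶜ blue = no λ ()
blue ≟ᶜ red  = no λ ()
blue ≟ᶜ blue = yes refl

¬red⇒blue : ∀ {x} → x ≢ red → x ≡ blue
¬red⇒blue {red}  ¬red = contradiction refl ¬red
¬red⇒blue {blue} _    = refl

-- The upper bound, by induction on the number of parts.

module Upper {N : ℕ} (c : Colouring N) where

  open Graph {Fin N} _≟_ (λ u v → col c u v ≡ red) (λ u v → col c u v ≟ᶜ red)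
    (λ {u} {v} uv → trans (Colouring.sym c v u) uv)

  -- Parts may exceed their prescribed sizes, so any sufficiently large set can serve as a part;
  -- trimming happens in `BlueFamily⇒multipartite`.
  record BlueFamily (U : List (Fin N)) {K : ℕ} (m : Fin K → ℕ) : Set where
    field
      part     : Fin K → List (Fin N)
      distinct : ∀ i → Unique (part i)
      within   : ∀ i → part i ⊆ U
      size     : ∀ i → m i ≤ length (part i)
      across   : ∀ {i j x y} → i ≢ j → x ∈ part i → y ∈ part j → x ≢ y × col c x y ≡ blue
  open BlueFamily

  far? : ∀ Z u → Dec (¬ Near Z u)
  far? Z u = ¬? (near? Z u)

  Far : List (Fin N) → List (Fin N) → List (Fin N)
  Far U Z = filter (far? Z) U

  far⇒blue : ∀ {U Z x y} → x ∈ Z → y ∈ Far U Z → x ≢ y × col c x y ≡ blue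
  far⇒blue {U} {Z} x∈Z y∈ with ∈-filter⁻ (far? Z) {xs = U} y∈
  ... | _ , ¬near = (λ x≡y → ¬near (lose x∈Z (inj₁ x≡y))) , ¬red⇒blue (λ xy → ¬near (lose x∈Z (inj₂ xy)))

  insertPart : ∀ {U Z K} {m : Fin (suc K) → ℕ} p → Unique Z → Z ⊆ U → m p ≤ length Z →
    BlueFamily (Far U Z) (m ∘ punchIn p) → BlueFamily U m
  insertPart {U} {Z} {K} {m} p uniqZ Z⊆U m≤Z F = record
    { part = part′ ; distinct = distinct′ ; within = within′ ; size = size′ ; across = across′ }
    where
    part′ : Fin (suc K) → List (Fin N)
    part′ i with p ≟ i
    ... | yes _  = Z
    ... | no p≢i = F .part (punchOut p≢i)
    distinct′ : ∀ i → Unique (part′ i)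
    distinct′ i with p ≟ i
    ... | yes _  = uniqZ
    ... | no p≢i = F .distinct (punchOut p≢i)
    within′ : ∀ i → part′ i ⊆ U
    within′ i x∈ with p ≟ i
    ... | yes _  = Z⊆U x∈
    ... | no p≢i = proj₁ (∈-filter⁻ (far? Z) (F .within (punchOut p≢i) x∈))
    size′ : ∀ i → m i ≤ length (part′ i)
    size′ i with p ≟ i
    ... | yes refl = m≤Z
    ... | no p≢i   = subst (λ j → m j ≤ length (F .part (punchOut p≢i))) (punchIn-punchOut p≢i) (F .size (punchOut p≢i))
    across′ : ∀ {i j x y} → i ≢ j → x ∈ part′ i → y ∈ part′ j → x ≢ y × col c x y ≡ blue
    across′ {i} {j} {x} {y} i≢j x∈ y∈ with p ≟ i | p ≟ j
    ... | yes refl | yes refl = contradiction refl i≢j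
    ... | yes refl | no p≢j   = far⇒blue {U} x∈ (F .within (punchOut p≢j) y∈)
    ... | no p≢i   | yes refl with far⇒blue {U} y∈ (F .within (punchOut p≢i) x∈)
    ...   | y≢x , yx = y≢x ∘ ≡-sym , trans (Colouring.sym c x y) yx
    across′ i≢j x∈ y∈ | no p≢i | no p≢j = F .across (i≢j ∘ punchOut-injective p≢i p≢j) x∈ y∈

  -- The size condition is stated for all pairs of parts, so that removing any part preserves it
  -- directly.
  Increasing : ℕ → ∀ {K} → (Fin K → ℕ) → Set
  Increasing n m = ∀ i j → i Data.Fin.< j → m i ≤ m j × 3 * m j + 5 * m i ≤ n

  Increasing-punchIn : ∀ {n K} {m : Fin (suc K) → ℕ} p → Increasing n m → Increasing n (m ∘ punchIn p)
  Increasing-punchIn p inc i j i<j = inc (punchIn p i) (punchIn p j)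
    (≤∧≢⇒< (punchIn-mono-≤ p i j (<⇒≤ i<j)) (<⇒≢ᶠ i<j ∘ punchIn-injective p i j ∘ toℕ-injective))

  -- There are `k + 1` parts. A single part is `U` itself; otherwise `a` and `b` of the expansion
  -- argument are `m zero` and `m (suc zero)`, and `Goal` includes long cycles found in recursive
  -- calls.
  upper : ∀ {n} → 1 ≤ n → ∀ k (m : Fin (suc k) → ℕ) → (∀ i → 1 ≤ m i) → Increasing n m →
    ∀ U → Unique U → k * (n ∸ 1) + m zero ≤ length U → BlueFamily U m ⊎ LongCycle n
  upper 1≤n zero m pos inc U uniqU m≤U = inj₁ record
    { part = λ _ → U ; distinct = λ _ → uniqU ; within = λ _ → id
    ; size = λ { zero → m≤U } ; across = λ { {zero} {zero} i≢j → contradiction refl i≢j } }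
  upper {n} 1≤n (suc k) m pos inc U uniqU bound =
    Sum.[ id , inj₂ ] (expanding⇒long-cycle uniqU (pos zero) (proj₂ m₀₁) (m+n≤o⇒n≤o _ bound)
      (λ Z uniqZ Z⊆U → expands zero Z uniqZ Z⊆U)
      (λ Z uniqZ Z⊆U m≤Z → Sum.map₂ (+-cancelʳ-≤ (m zero) n _) (expands (suc zero) Z uniqZ Z⊆U m≤Z)))
    where
    m₀₁ = inc zero (suc zero) (s≤s z≤n)
    -- The first part left after removing `p` has size `m (punchIn p zero)`. For `p = zero` this is
    -- `b`, as the expansion of sets of size `a` requires; for `p = suc zero` it is `m zero`, which
    -- cancels.
    expands : ∀ p Z → Unique Z → Z ⊆ U → m p ≤ length Z →
      (BlueFamily U m ⊎ LongCycle n) ⊎ n + m zero ≤ length (Γ U Z) + m (punchIn p zero)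
    expands p Z uniqZ Z⊆U m≤Z with k * (n ∸ 1) + m (punchIn p zero) ≤? length (Far U Z)
    ... | yes R≥ = inj₁ (Sum.map₁ (insertPart p uniqZ Z⊆U m≤Z)
      (upper 1≤n k (m ∘ punchIn p) (pos ∘ punchIn p) (Increasing-punchIn p inc)
        (Far U Z) (Unique.filter⁺ (far? Z) uniqU) R≥))
    -- `Γ U Z` and `Far U Z` cover `U`. The strictness of the failed bound on `Far U Z` supplies the
    -- unit that turns `n ∸ 1` into `n`.
    ... | no R≱ = inj₂ (+-cancelˡ-≤ kd _ _ (begin
      kd + (n + m zero)                      ≡⟨ cong (λ x → kd + (x + m zero)) (m+[n∸m]≡n 1≤n) ⟨
      kd + (1 + (n ∸ 1) + m zero)            ≡⟨ eq₁ kd (n ∸ 1) (m zero) ⟩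
      suc ((n ∸ 1) + kd + m zero)            ≤⟨ s≤s bound ⟩
      suc (length U)                         ≤⟨ s≤s (Unique-⊆⇒length≤ uniqU U⊆) ⟩
      suc (length (Γ U Z ++ Far U Z))        ≡⟨ cong suc (length-++ (Γ U Z)) ⟩
      suc (length (Γ U Z) + length (Far U Z)) ≡⟨ +-suc _ _ ⟨
      length (Γ U Z) + suc (length (Far U Z)) ≤⟨ +-monoʳ-≤ (length (Γ U Z)) (≰⇒> R≱) ⟩
      length (Γ U Z) + (kd + m (punchIn p zero)) ≡⟨ eq₂ (length (Γ U Z)) kd (m (punchIn p zero)) ⟩
      kd + (length (Γ U Z) + m (punchIn p zero)) ∎))
      where
      open ≤-Reasoning
      kd = k * (n ∸ 1)
      eq₁ : ∀ x y z → x + (1 + y + z) ≡ 1 + (y + x + z)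
      eq₁ = solve-∀
      eq₂ : ∀ x y z → x + (y + z) ≡ y + (x + z)
      eq₂ = solve-∀
      U⊆ : U ⊆ Γ U Z ++ Far U Z
      U⊆ {u} u∈U with near? Z u
      ... | yes near = ∈-++⁺ˡ (∈-filter⁺ (near? Z) u∈U near)
      ... | no ¬near = ∈-++⁺ʳ (Γ U Z) (∈-filter⁺ (far? Z) u∈U ¬near)

  BlueFamily⇒multipartite : ∀ {U K} {m : Fin K → ℕ} → BlueFamily U m → BlueCompleteMultipartite K m c
  BlueFamily⇒multipartite {m = m} F = f , f-injective ,
    λ i j a b i≢j → proj₂ (F .across i≢j (∈-lookup (inject≤ a (F .size i))) (∈-lookup (inject≤ b (F .size j))))
    where
    f : KVert _ m → Fin N
    f (i , a) = lookup (F .part i) (inject≤ a (F .size i))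
    f-injective : ∀ {x y} → f x ≡ f y → x ≡ y
    f-injective {i , a} {j , b} eq with i ≟ j
    ... | no i≢j   = contradiction eq (proj₁ (F .across i≢j (∈-lookup (inject≤ a (F .size i))) (∈-lookup (inject≤ b (F .size j)))))
    ... | yes refl = cong (i ,_) (inject≤-injective _ _ a b (lookup-injective (F .distinct i) eq))

  -- `LongCycle` admits a single vertex and an edge run back and forth; `3 ≤ n` excludes both.
  LongCycle⇒red : ∀ {n} → 3 ≤ n → LongCycle n → RedCycleAtLeast n c
  LongCycle⇒red 3≤n (.[] , v , n≤ , _ , _ , inj₁ refl) = contradiction (≤-trans 3≤n n≤) λ { (s≤s ()) }
  LongCycle⇒red 3≤n (.(s ∷ ms) , v , n≤ , uniq , path , inj₂ (s , ms , refl , sv)) =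
    length (ms ++ [ v ]) , n≤ , ≤-trans 3≤n n≤ , lookup (s ∷ ms ++ [ v ]) , lookup-injective uniq ,
    (λ i → path (lookup-Next s (ms ++ [ v ]) i)) ,
    trans (cong (λ x → col c x s) (lookup-last s ms v)) (trans (Colouring.sym c v s) sv)

-- The lower bound: disjoint red cliques.

module Lower (d : ℕ) .{{_ : NonZero d}} where

  -- With `d` equal to `n - 1`, the blocks are intervals of `d` consecutive vertices, the last
  -- possibly shorter.
  block : ∀ {N} → Fin N → ℕ
  block u = toℕ u / d

  same : ℕ → ℕ → Colour
  same x y with x ℕ.≟ y
  ... | yes _ = red
  ... | no  _ = blue

  same-red : ∀ {x y} → same x y ≡ red → x ≡ y
  same-red {x} {y} eq with x ℕ.≟ y
  ... | yes x≡y = x≡y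

  same-blue : ∀ {x y} → same x y ≡ blue → x ≢ y
  same-blue {x} {y} eq with x ℕ.≟ y
  ... | no x≢y = x≢y

  same-sym : ∀ x y → same x y ≡ same y x
  same-sym x y with x ℕ.≟ y | y ℕ.≟ x
  ... | yes _   | yes _   = refl
  ... | no  _   | no  _   = refl
  ... | yes x≡y | no  y≢x = contradiction (≡-sym x≡y) y≢x
  ... | no  x≢y | yes y≡x = contradiction (≡-sym y≡x) x≢y

  blocks : ∀ N → Colouring N
  blocks N = record { col = λ u v → same (block u) (block v) ; sym = λ u v → same-sym (block u) (block v) }

  block-rem-injective : ∀ {N} {u v : Fin N} → block u ≡ block v → toℕ u % d ≡ toℕ v % d → u ≡ v
  block-rem-injective {u = u} {v} qs rs = toℕ-injective (begin
    toℕ u                          ≡⟨ m≡m%n+[m/n]*n (toℕ u) d ⟩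
    toℕ u % d + toℕ u / d * d      ≡⟨ cong (λ q → toℕ u % d + q * d) qs ⟩
    toℕ u % d + toℕ v / d * d      ≡⟨ cong (_+ toℕ v / d * d) rs ⟩
    toℕ v % d + toℕ v / d * d      ≡⟨ m≡m%n+[m/n]*n (toℕ v) d ⟨
    toℕ v                          ∎)
    where open ≡-Reasoning

  constant : ∀ {l} (h : Fin (suc l) → ℕ) → (∀ i → h (inject₁ i) ≡ h (suc i)) → ∀ i → h i ≡ h zero
  constant h step zero = refl
  constant {suc l} h step (suc i) = trans (constant (h ∘ suc) (step ∘ suc) i) (≡-sym (step zero))

  crowded-block : ∀ {N K r} (f : Fin K → Fin N) → r < K → (∀ i j → block (f i) ≡ block (f j)) →
    (∀ i → toℕ (f i) % d < r) → ∃₂ λ i j → i ≢ j × f i ≡ f j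
  crowded-block f r<K q r with pigeonhole r<K (λ i → fromℕ< (r i))
  ... | i , j , i<j , eq = i , j , <⇒≢ᶠ i<j , block-rem-injective (q i j) (fromℕ<-injective _ _ (r i) (r j) eq)

  no-red-cycle : ∀ {N} → ¬ RedCycleAtLeast (suc d) (blocks N)
  no-red-cycle (l , d<l , _ , f , inj , red-path , _)
    with crowded-block f d<l
      (λ i j → trans (same-block i) (≡-sym (same-block j))) (λ i → m%n<n (toℕ (f i)) d)
    where
    same-block = constant (block ∘ f) (same-red ∘ red-path)
  ... | i , j , i≢j , eq = i≢j (inj eq)

  -- Every part has more vertices than block number `k`, so it meets one of the first `k` blocks.
  -- Two of the `k + 1` parts then meet the same block, where all edges are red.
  no-blue-multipartite : ∀ {N} k (m : Fin (suc k) → ℕ) → 1 ≤ m zero → (∀ i → m zero ≤ m i) → m zero ≤ d →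
    N < k * d + m zero → ¬ BlueCompleteMultipartite (suc k) m (blocks N)
  no-blue-multipartite {N} k m 1≤m₀ m₀≤ m₀≤d N< (f , inj , blue-across) =
    no-early-choice (λ i → proj₁ (leaves-last-block i))
      (λ i → ≤∧≢⇒< (s≤s⁻¹ (block≤k _)) (proj₂ (leaves-last-block i)))
    where
    block≤k : ∀ u → block {N} u < suc k
    block≤k u = m<n*o⇒m/o<n (begin-strict
      toℕ u            <⟨ toℕ<n u ⟩
      N                <⟨ N< ⟩
      k * d + m zero   ≤⟨ +-monoʳ-≤ (k * d) m₀≤d ⟩
      k * d + d        ≡⟨ +-comm (k * d) d ⟩
      suc k * d        ∎)
      where open ≤-Reasoning
    -- Vertices count from zero and `N` is at most `k * d + (m zero ∸ 1)`, so block number `k` has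
    -- at most `m zero ∸ 1` vertices.
    in-last-block⇒small : ∀ u → block {N} u ≡ k → toℕ u % d < m zero ∸ 1
    in-last-block⇒small u q = m+n≤o⇒m≤o∸n (suc (toℕ u % d)) (+-cancelʳ-≤ (k * d) (suc (toℕ u % d) + 1) (m zero) (begin
      suc (toℕ u % d) + 1 + k * d     ≡⟨ cong (_+ k * d) (+-comm (suc (toℕ u % d)) 1) ⟩
      suc (suc (toℕ u % d + k * d))   ≡⟨ cong (λ q → suc (suc (toℕ u % d + q * d))) q ⟨
      suc (suc (toℕ u % d + toℕ u / d * d)) ≡⟨ cong (λ x → suc (suc x)) (m≡m%n+[m/n]*n (toℕ u) d) ⟨
      suc (suc (toℕ u))               ≤⟨ s≤s (toℕ<n u) ⟩
      suc N                           ≤⟨ N< ⟩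
      k * d + m zero                  ≡⟨ +-comm (k * d) (m zero) ⟩
      m zero + k * d                  ∎))
      where open ≤-Reasoning
    not-all-last : ∀ i → ¬ (∀ a → block (f (i , a)) ≡ k)
    not-all-last i all-last
      with crowded-block {r = m zero ∸ 1} (λ a → f (i , a)) (≤-trans (≤-reflexive (m+[n∸m]≡n 1≤m₀)) (m₀≤ i))
             (λ a b → trans (all-last a) (≡-sym (all-last b))) (λ a → in-last-block⇒small _ (all-last a))
    ... | a , b , a≢b , eq with inj eq
    ...   | refl = a≢b refl
    leaves-last-block : ∀ i → ∃[ a ] block (f (i , a)) ≢ k
    leaves-last-block i = ¬∀⟶∃¬ (m i) (λ a → block (f (i , a)) ≡ k) (λ a → block (f (i , a)) ℕ.≟ k) (not-all-last i)
    no-early-choice : (a : ∀ i → Fin (m i)) → ¬ (∀ i → block (f (i , a i)) < k)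
    no-early-choice a early with pigeonhole ≤-refl (λ i → fromℕ< (early i))
    ... | i , j , i<j , eq = same-blue (blue-across i j (a i) (a j) (<⇒≢ᶠ i<j))
      (fromℕ<-injective _ _ (early i) (early j) eq)

-- Combining the two bounds.

≤-secondLastPart : ∀ k (m : Fin (suc k) → ℕ) → (∀ i j → i Data.Fin.≤ j → m i ≤ m j) →
  ∀ (i j : Fin (suc k)) → i Data.Fin.< j → m i ≤ secondLastPart k m
≤-secondLastPart zero    m mono zero zero ()
≤-secondLastPart (suc k) m mono i j i<j = mono i (inject₁ (fromℕ k)) (begin
  toℕ i                       ≤⟨ s≤s⁻¹ (≤-trans i<j (≤fromℕ j)) ⟩
  toℕ (fromℕ k)               ≡⟨ toℕ-inject₁ (fromℕ k) ⟨
  toℕ (inject₁ (fromℕ k))     ∎)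
  where open ≤-Reasoning

theorem1p2 : (k : ℕ) (m : Fin (suc k) → ℕ) →
    (∀ i → 1 ≤ m i) →
    (∀ i j → i Data.Fin.≤ j → m i ≤ m j) →
    (n : ℕ) → 3 * lastPart k m + 5 * secondLastPart k m ≤ n →
    IsRamseyNumber n (suc k) m (k * (n ∸ 1) + m zero)
theorem1p2 k m pos mono n large = arrows , minimal 3≤n 3m≤n
  where
  3m≤n : 3 * lastPart k m ≤ n
  3m≤n = m+n≤o⇒m≤o _ large
  3≤n : 3 ≤ n
  3≤n = ≤-trans (*-monoʳ-≤ 3 (pos (fromℕ k))) 3m≤n
  arrows : Arrows (k * (n ∸ 1) + m zero) n (suc k) m
  arrows c = swap (Sum.map BlueFamily⇒multipartite (LongCycle⇒red 3≤n)
    (upper (≤-trans (s≤s z≤n) 3≤n) k m pos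
      -- `m j` is at most the last part and `m i` at most the second last, so `large` covers every
      -- pair.
      (λ i j i<j → mono i j (<⇒≤ i<j) ,
        ≤-trans (+-mono-≤ (*-monoʳ-≤ 3 (mono j (fromℕ k) (≤fromℕ j))) (*-monoʳ-≤ 5 (≤-secondLastPart k m mono i j i<j))) large)
      (allFin R) (Unique.allFin⁺ R) (≤-reflexive (≡-sym (length-tabulate id)))))
    where
    open Upper c
    R = k * (n ∸ 1) + m zero
  minimal : ∀ {n} → 3 ≤ n → 3 * lastPart k m ≤ n → ∀ N → N < k * (n ∸ 1) + m zero → ¬ Arrows N n (suc k) m
  minimal {suc zero} (s≤s ())
  -- The red cliques have at most `d = n - 1` vertices; matching `d` as a successor supplies
  -- `NonZero d`.
  minimal {suc d@(suc _)} _ 3m≤1+d N N<R arr with arr (Lower.blocks d N)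
  ... | inj₁ cycle = Lower.no-red-cycle d cycle
  ... | inj₂ multi = Lower.no-blue-multipartite d k m (pos zero) (λ i → mono zero i z≤n) m₀≤d N<R multi
    where
    m₀≤d : m zero ≤ d
    m₀≤d = s≤s⁻¹ (begin
      1 + m zero              ≤⟨ +-mono-≤ (pos zero) (m≤m+n (m zero) _) ⟩
      3 * m zero              ≤⟨ *-monoʳ-≤ 3 (mono zero (fromℕ k) z≤n) ⟩
      3 * lastPart k m        ≤⟨ 3m≤1+d ⟩
      suc d                   ∎)
      where open ≤-Reasoning
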